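{- Every program that admits a quasi-interpretation is quasi-friendly.
   Context: **Programs.** The vocabulary consists of four disjoint sets of symbols: variables $\mathit{Var}$, constructor symbols $\mathit{Cns}$, operator symbols $\mathit{Op}$, function symbols $\mathit{Fct}$; all symbols of the last three sets have an arity. Compositional expressions are $e ::= x \mid c(e_1,\ldots,e_n)\mid op(e_1,\ldots,e_n)\mid f(e_1,\ldots,e_n)$ with $x\in\mathit{Var}$, $c\in\mathit{Cns}$, $op\in\mathit{Op}$, $f\in\mathit{Fct}$; patterns are $p::=x\mid c(p_1,\ldots,p_n)$. A program is a finite list of definitions, one $f(x_1,\ldots,x_n)=e^f$ for each of its function symbols $f$, where $e^f$ is either a compositional expression, or $\mathbf{Case}\ x_1,\ldots,x_n\ \mathbf{of}\ \overline{p_1}\to e^1\ \ldots\ \overline{p_\ell}\to e^\ell$ where each $\overline{p_j}=p_{j,1},\ldots,p_{j,n}$ is a sequence of $n$ patterns, the pattern sequences are non-overlapping, and each $e^j$ is a compositional expression (no nested Case). Every variable of $e^f$ is a parameter $x_i$ or occurs in a pattern (of the branch considered). **Semantics.** $\mathit{Values}$ is the set of ground constructor terms, $\mathit{Values}^*=\mathit{Values}\cup\{\mathbf{Err}\}$. Each operator $op$ of arity $n$ is interpreted by a function $[\![op]\!]$ from $\mathit{Values}^n$ to $\mathit{Values}^*$. Operators are basic partial functions: destructors (returning a subterm of an argument, or $\mathbf{Err}$) or characteristic functions of predicates (returning a $0$-ary truth-value constructor, or $\mathbf{Err}$). Evaluation $e\downarrow w$ of ground expressions is call-by-value: $c(e_1,\ldots,e_n)\downarrow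 c(w_1,\ldots,w_n)$ and $op(e_1,\ldots,e_n)\downarrow [\![op]\!](w_1,\ldots,w_n)$ if $e_i\downarrow w_i\neq\mathbf{Err}$ for all $i$; $f(e_1,\ldots,e_n)\downarrow w$ if $e_i\downarrow w_i\ne\mathbf{Err}$ for all $i$ and $e^f\sigma\downarrow w$ with $\sigma(x_i)=w_i$, where a Case expression is evaluated by selecting the branch $j$ whose patterns match, $p_{j,i}\sigma'=w_i$, and evaluating $e^j$ under the matching substitution. If no rule is applicable the result is $\mathbf{Err}$. Write $[\![e]\!]=w$ iff $e\downarrow w$ (undefined if evaluation does not terminate), and $[\![b]\!](v_1,\ldots,v_n)=[\![b(v_1,\ldots,v_n)]\!]$ for a symbol $b$. **Size.** $|e|=0$ if $e$ is a $0$-ary symbol or $\mathbf{Err}$, and $|b(e_1,\ldots,e_n)|=1+\sum_i|e_i|$ if $n>0$. **Activation, precedence, fraternities.** A context $\mathsf C[\diamond_1,\ldots,\diamond_r]$ is an expression with one occurrence of each fresh variable $\diamond_i$; $\mathsf C[d_1,\ldots,d_r]$ is the result of substituting $d_i$ for $\diamond_i$. An expression $d$ is activated by $f(p_1,\ldots,p_n)$ if for some one-hole context $\mathsf C$: either $e^f$ is compositional, $e^f=\mathsf C[d]$ and $p_i=x_i$ for all $i$; or $e^f$ is a Case expression and for some branch $j$, $e^j=\mathsf C[d]$ and $p_i=p_{j,i}$ for all $i$. It is maximal if there is no context $\mathsf C[\diamond]$ other than the empty one with $\mathsf C[d]$ activated by $f(p_1,\ldots,p_n)$. The preorder $\ge_{\mathcal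 F}$ on function symbols is the reflexive transitive closure of: $f\ge_{\mathcal F} g$ if some $g(\overline e)$ is activated by some $f(\overline p)$. Write $f\approx_{\mathcal F}g$ if $f\ge_{\mathcal F}g$ and $g\ge_{\mathcal F}f$; $f>_{\mathcal F}g$ if $f\ge_{\mathcal F}g$ and not $g\ge_{\mathcal F}f$. An expression $\mathsf C[g_1(\overline{e_1}),\ldots,g_r(\overline{e_r})]$ ($r\ge1$) activated by $f(p_1,\ldots,p_n)$ is a fraternity if it is maximal, $g_i\approx_{\mathcal F}f$ for all $i$, and $f>_{\mathcal F}h$ for every function symbol $h$ occurring in the context $\mathsf C[\diamond_1,\ldots,\diamond_r]$. **Assignments.** A partial assignment $I$ maps each symbol $b$ of arity $n$ in its domain $\mathrm{dom}(I)$ to a function $I(b):(\mathbb R^+)^n\to\mathbb R^+$ ($\mathbb R^+$: nonnegative reals), with $\mathit{Cns}\cup\mathit{Op}\subseteq\mathrm{dom}(I)$. Its canonical extension $I^*$ to expressions whose symbols are in $\mathrm{dom}(I)$ is $I^*(x)=X$ (a variable ranging over $\mathbb R^+$, one for each $x\in\mathit{Var}$, also for each $\diamond_i$) and $I^*(b(e_1,\ldots,e_n))=I(b)(I^*(e_1),\ldots,I^*(e_n))$. Standing assumption: all assignments are additive, i.e. every $I(b)$ is bounded by a polynomial in $\mathbb R^+[X_1,\ldots,X_n]$, and each constructor $c$ of arity $n>0$ has $I(c)(X_1,\ldots,X_n)=\sum_iX_i+\alpha_c$ with $\alpha_c\ge1$; $0$-ary constructors and $\mathbf{Err}$ are assigned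 $0$. **Sup-interpretation.** A partial assignment $\theta$ such that: (1) each $\theta(b)$, $b\in\mathrm{dom}(\theta)$, is weakly monotonic ($X_i\ge Y_i$ for all $i$ implies $\theta(b)(X_1,\ldots,X_n)\ge\theta(b)(Y_1,\ldots,Y_n)$); (2) $\theta^*(v)\ge|v|$ for all $v\in\mathit{Values}^*$; (3) for each $b\in\mathrm{dom}(\theta)$ of arity $n$ and $v_1,\ldots,v_n\in\mathit{Values}$, if $[\![b]\!](v_1,\ldots,v_n)$ is defined in $\mathit{Values}^*$ then $\theta^*(b(v_1,\ldots,v_n))\ge\theta^*([\![b]\!](v_1,\ldots,v_n))$. **Weight.** A weight $\omega$ assigns to function symbols $f$ of arity $n$ a total function $\omega_f:(\mathbb R^+)^n\to\mathbb R^+$, bounded by a polynomial, weakly monotonic, and with the subterm property $\omega_f(\ldots,X_i,\ldots)\ge X_i$ for all $i$. **Quasi-friendly.** A program is quasi-friendly iff there are a sup-interpretation $\theta$ and a weight $\omega$ such that for each fraternity $\mathsf C[g_1(\overline{e_1}),\ldots,g_r(\overline{e_r})]$ activated by some $f(p_1,\ldots,p_n)$, with all needed quantities defined and for all nonnegative real values of the variables: 1. $\omega_f(\theta^*(p_1),\ldots,\theta^*(p_n))\ge\max_{i=1..r}\omega_{g_i}(\theta^*(\overline{e_i}))$; 2. $\omega_f(\theta^*(p_1),\ldots,\theta^*(p_n))\ge\theta^*(\mathsf C)[\omega_{g_1}(\theta^*(\overline{e_1})),\ldots,\omega_{g_r}(\theta^*(\overline{e_r}))]$. Here $\theta^*(\overline{e_i})$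 as an argument of $\omega_{g_i}$ is the tuple of the $\theta^*$ of the components of $\overline{e_i}$, and $\theta^*(\mathsf C)[Y_1,\ldots,Y_r]$ is $\theta^*(\mathsf C[\diamond_1,\ldots,\diamond_r])$ with $\diamond_i$ valued $Y_i$. **Quasi-interpretation.** A quasi-interpretation of a program is a total additive assignment $(\!|-|\!)$ (defined on every symbol of the program), extended canonically to expressions, which is (weakly) monotonic, has the subterm property ($(\!|b|\!)(\ldots,X_i,\ldots)\ge X_i$ for every symbol $b$ of arity $n$ and every $i\in\{1,\ldots,n\}$), and such that for every maximal expression $e$ activated by some $f(p_1,\ldots,p_n)$, $(\!|f(p_1,\ldots,p_n)|\!)\ge(\!|e|\!)$ for all nonnegative real values of the variables. -}

module Defs where

open import Data.Bool using (if_then_else_)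
open import Data.Empty using (⊥; ⊥-elim)
open import Data.Fin using (Fin; zero; suc)
open import Data.Fin.Properties using (_≟_)
open import Data.Integer using (+_)
open import Data.List as List using (List)
open import Data.Nat as ℕ using (ℕ; zero; suc)
import Data.Nat.Properties as ℕ
open import Data.Product using (Σ; ∃-syntax; _×_; _,_; proj₁; proj₂)
open import Data.Rational as ℚ using (ℚ; 0ℚ; 1ℚ; ½; ∣_∣)
import Data.Rational.Properties as ℚ
open import Data.Rational.Solver using (module +-*-Solver)
open import Data.Sum using (_⊎_; inj₁; inj₂; [_,_]′)
open import Data.Unit using (⊤)
open import Data.Vec as Vec using (Vec; []; _∷_; lookup; tabulate)
open import Data.Vec.Relation.Binary.Pointwise.Inductive using (Pointwise)
open import Data.Vec.Relation.Unary.Any using (Any)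
open import Relation.Binary.Construct.Closure.ReflexiveTransitive using (Star)
open import Relation.Binary.PropositionalEquality
  using (_≡_; _≢_; refl; sym; cong; subst; module ≡-Reasoning)
open import Relation.Nullary using (¬_; does)

------------------------------------------------------------------------
-- Real numbers: Cauchy sequences of rationals, compared up to _≈ℝ_. Eta is
-- switched off because it makes conversion checking unfold rational arithmetic.

record ℝ : Set where
  no-eta-equality
  field
    seq    : ℕ → ℚ
    cauchy : ∀ ε → 0ℚ ℚ.< ε → ∃[ N ] (∀ m n → N ℕ.≤ m → N ℕ.≤ n →
             ∣ seq m ℚ.- seq n ∣ ℚ.≤ ε)
open ℝ public

infix 4 _≤ℝ_ _≈ℝ_

record _≤ℝ_ (x y : ℝ) : Set where
  no-eta-equality
  constructor mk≤
  field
    eventually : ∀ ε → 0ℚ ℚ.< ε → ∃[ N ] (∀ n → N ℕ.≤ n →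
                 seq x n ℚ.≤ seq y n ℚ.+ ε)
open _≤ℝ_ public

_≈ℝ_ : ℝ → ℝ → Set
x ≈ℝ y = x ≤ℝ y × y ≤ℝ x

fromℚ : ℚ → ℝ
fromℚ q .seq _ = q
fromℚ q .cauchy ε 0<ε = 0 , λ _ _ _ _ →
  subst (λ d → ∣ d ∣ ℚ.≤ ε) (sym (ℚ.+-inverseʳ q)) (ℚ.<⇒≤ 0<ε)

fromℕ : ℕ → ℝ
fromℕ n = fromℚ (+ n ℚ./ 1)

0ℝ 1ℝ : ℝ
0ℝ = fromℕ 0
1ℝ = fromℕ 1

private
  open +-*-Solver using (solve; _:=_; _:+_; _:*_; _:-_)

  sum-split : ∀ a b c d → (a ℚ.+ b) ℚ.- (c ℚ.+ d) ≡ (a ℚ.- c) ℚ.+ (b ℚ.- d)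
  sum-split = solve 4 (λ a b c d →
    (a :+ b) :- (c :+ d) := (a :- c) :+ (b :- d)) refl

  product-split : ∀ a b c d →
    (a ℚ.* b) ℚ.- (c ℚ.* d) ≡ a ℚ.* (b ℚ.- d) ℚ.+ (a ℚ.- c) ℚ.* d
  product-split = solve 4 (λ a b c d →
    (a :* b) :- (c :* d) := a :* (b :- d) :+ (a :- c) :* d) refl

  difference : ∀ a b → a ≡ (a ℚ.- b) ℚ.+ b
  difference = solve 2 (λ a b → a := (a :- b) :+ b) refl

  halves : ∀ a → ½ ℚ.* a ℚ.+ ½ ℚ.* a ≡ a
  halves a = begin
    ½ ℚ.* a ℚ.+ ½ ℚ.* a  ≡⟨ ℚ.*-distribʳ-+ a ½ ½ ⟨
    1ℚ ℚ.* a             ≡⟨ ℚ.*-identityˡ a ⟩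
    a                    ∎
    where open ≡-Reasoning

  half-positive : ∀ {ε} → 0ℚ ℚ.< ε → 0ℚ ℚ.< ½ ℚ.* ε
  half-positive {ε} 0<ε =
    ℚ.positive⁻¹ _ {{ℚ.pos*pos⇒pos ½ ε {{ℚ.positive 0<ε}}}}

  quotient : ∀ {ε D} → 0ℚ ℚ.< ε → 0ℚ ℚ.< D → ∃[ δ ] (0ℚ ℚ.< δ × δ ℚ.* D ≡ ε)
  quotient {ε} {D} 0<ε 0<D = ε ℚ.* D⁻¹ ,
    ℚ.positive⁻¹ (ε ℚ.* D⁻¹)
      {{ℚ.pos*pos⇒pos ε {{ℚ.positive 0<ε}} D⁻¹ {{ℚ.1/pos⇒pos D {{ℚ.positive 0<D}}}}}} ,
    (begin
      ε ℚ.* D⁻¹ ℚ.* D    ≡⟨ ℚ.*-assoc ε D⁻¹ D ⟩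
      ε ℚ.* (D⁻¹ ℚ.* D)  ≡⟨ cong (ε ℚ.*_) (ℚ.*-inverseˡ D {{D≢0}}) ⟩
      ε ℚ.* 1ℚ           ≡⟨ ℚ.*-identityʳ ε ⟩
      ε                  ∎)
    where
    open ≡-Reasoning
    D≢0 : ℚ.NonZero D
    D≢0 = ℚ.pos⇒nonZero D {{ℚ.positive 0<D}}
    D⁻¹ : ℚ
    D⁻¹ = (ℚ.1/ D) {{D≢0}}

  bound : ∀ x → ∃[ B ] (0ℚ ℚ.< B × ∃[ N ] (∀ n → N ℕ.≤ n → ∣ seq x n ∣ ℚ.≤ B))
  bound x with cauchy x 1ℚ (ℚ.positive⁻¹ 1ℚ)
  ... | N , near = 1ℚ ℚ.+ ∣ seq x N ∣ ,
    ℚ.+-mono-<-≤ (ℚ.positive⁻¹ 1ℚ) (ℚ.0≤∣p∣ (seq x N)) , N , bounded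
    where
    open ℚ.≤-Reasoning
    bounded : ∀ n → N ℕ.≤ n → ∣ seq x n ∣ ℚ.≤ 1ℚ ℚ.+ ∣ seq x N ∣
    bounded n N≤n = begin
      ∣ seq x n ∣
        ≡⟨ cong ∣_∣ (difference (seq x n) (seq x N)) ⟩
      ∣ (seq x n ℚ.- seq x N) ℚ.+ seq x N ∣
        ≤⟨ ℚ.∣p+q∣≤∣p∣+∣q∣ (seq x n ℚ.- seq x N) (seq x N) ⟩
      ∣ seq x n ℚ.- seq x N ∣ ℚ.+ ∣ seq x N ∣
        ≤⟨ ℚ.+-monoˡ-≤ ∣ seq x N ∣ (near n N N≤n ℕ.≤-refl) ⟩
      1ℚ ℚ.+ ∣ seq x N ∣ ∎

  *-mono-∣∣ : ∀ p q {B C} → ∣ p ∣ ℚ.≤ B → ∣ q ∣ ℚ.≤ C → ∣ p ℚ.* q ∣ ℚ.≤ B ℚ.* C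
  *-mono-∣∣ p q {B} {C} p≤B q≤C = begin
    ∣ p ℚ.* q ∣      ≡⟨ ℚ.∣p*q∣≡∣p∣*∣q∣ p q ⟩
    ∣ p ∣ ℚ.* ∣ q ∣  ≤⟨ ℚ.*-monoʳ-≤-nonNeg ∣ q ∣ {{ℚ.∣-∣-nonNeg q}} p≤B ⟩
    B ℚ.* ∣ q ∣      ≤⟨ ℚ.*-monoˡ-≤-nonNeg B
                          {{ℚ.nonNegative (ℚ.≤-trans (ℚ.0≤∣p∣ p) p≤B)}} q≤C ⟩
    B ℚ.* C          ∎
    where open ℚ.≤-Reasoning

  sum-near : ∀ a b c d {δ} → ∣ a ℚ.- c ∣ ℚ.≤ δ → ∣ b ℚ.- d ∣ ℚ.≤ δ →
             ∣ (a ℚ.+ b) ℚ.- (c ℚ.+ d) ∣ ℚ.≤ δ ℚ.+ δ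
  sum-near a b c d {δ} a≈c b≈d = begin
    ∣ (a ℚ.+ b) ℚ.- (c ℚ.+ d) ∣    ≡⟨ cong ∣_∣ (sum-split a b c d) ⟩
    ∣ (a ℚ.- c) ℚ.+ (b ℚ.- d) ∣    ≤⟨ ℚ.∣p+q∣≤∣p∣+∣q∣ (a ℚ.- c) (b ℚ.- d) ⟩
    ∣ a ℚ.- c ∣ ℚ.+ ∣ b ℚ.- d ∣    ≤⟨ ℚ.+-mono-≤ a≈c b≈d ⟩
    δ ℚ.+ δ                        ∎
    where open ℚ.≤-Reasoning

  product-near : ∀ a b c d {B C δ} → ∣ a ∣ ℚ.≤ B → ∣ d ∣ ℚ.≤ C →
                 ∣ a ℚ.- c ∣ ℚ.≤ δ → ∣ b ℚ.- d ∣ ℚ.≤ δ →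
                 ∣ (a ℚ.* b) ℚ.- (c ℚ.* d) ∣ ℚ.≤ δ ℚ.* (B ℚ.+ C)
  product-near a b c d {B} {C} {δ} a≤B d≤C a≈c b≈d = begin
    ∣ (a ℚ.* b) ℚ.- (c ℚ.* d) ∣
      ≡⟨ cong ∣_∣ (product-split a b c d) ⟩
    ∣ a ℚ.* (b ℚ.- d) ℚ.+ (a ℚ.- c) ℚ.* d ∣
      ≤⟨ ℚ.∣p+q∣≤∣p∣+∣q∣ (a ℚ.* (b ℚ.- d)) ((a ℚ.- c) ℚ.* d) ⟩
    ∣ a ℚ.* (b ℚ.- d) ∣ ℚ.+ ∣ (a ℚ.- c) ℚ.* d ∣
      ≤⟨ ℚ.+-mono-≤ (*-mono-∣∣ a (b ℚ.- d) a≤B b≈d) (*-mono-∣∣ (a ℚ.- c) d a≈c d≤C) ⟩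
    B ℚ.* δ ℚ.+ δ ℚ.* C
      ≡⟨ cong (ℚ._+ δ ℚ.* C) (ℚ.*-comm B δ) ⟩
    δ ℚ.* B ℚ.+ δ ℚ.* C
      ≡⟨ ℚ.*-distribˡ-+ δ B C ⟨
    δ ℚ.* (B ℚ.+ C) ∎
    where open ℚ.≤-Reasoning

  sum-cauchy : ∀ x y ε → 0ℚ ℚ.< ε → ∃[ N ] (∀ m n → N ℕ.≤ m → N ℕ.≤ n →
    ∣ (seq x m ℚ.+ seq y m) ℚ.- (seq x n ℚ.+ seq y n) ∣ ℚ.≤ ε)
  sum-cauchy x y ε 0<ε =
    let M , nearx = cauchy x (½ ℚ.* ε) (half-positive 0<ε)
        N , neary = cauchy y (½ ℚ.* ε) (half-positive 0<ε)
    in M ℕ.⊔ N , λ m n m≥ n≥ → subst (_ ℚ.≤_) (halves ε)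
      (sum-near (seq x m) (seq y m) (seq x n) (seq y n)
        (nearx m n (ℕ.m⊔n≤o⇒m≤o M N m≥) (ℕ.m⊔n≤o⇒m≤o M N n≥))
        (neary m n (ℕ.m⊔n≤o⇒n≤o M N m≥) (ℕ.m⊔n≤o⇒n≤o M N n≥)))

  product-cauchy : ∀ x y ε → 0ℚ ℚ.< ε → ∃[ N ] (∀ m n → N ℕ.≤ m → N ℕ.≤ n →
    ∣ (seq x m ℚ.* seq y m) ℚ.- (seq x n ℚ.* seq y n) ∣ ℚ.≤ ε)
  product-cauchy x y ε 0<ε =
    let B , 0<B , M₁ , x≤B = bound x
        C , 0<C , N₁ , y≤C = bound y
        δ , 0<δ , δ[B+C]≡ε = quotient 0<ε (ℚ.+-mono-< 0<B 0<C)
        M₂ , nearx = cauchy x δ 0<δ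
        N₂ , neary = cauchy y δ 0<δ
        M = M₁ ℕ.⊔ M₂
        N = N₁ ℕ.⊔ N₂
    in M ℕ.⊔ N , λ m n m≥ n≥ →
      let m≥M = ℕ.m⊔n≤o⇒m≤o M N m≥
          m≥N = ℕ.m⊔n≤o⇒n≤o M N m≥
          n≥M = ℕ.m⊔n≤o⇒m≤o M N n≥
          n≥N = ℕ.m⊔n≤o⇒n≤o M N n≥
      in subst (_ ℚ.≤_) δ[B+C]≡ε
        (product-near (seq x m) (seq y m) (seq x n) (seq y n)
          (x≤B m (ℕ.m⊔n≤o⇒m≤o M₁ M₂ m≥M))
          (y≤C n (ℕ.m⊔n≤o⇒m≤o N₁ N₂ n≥N))
          (nearx m n (ℕ.m⊔n≤o⇒n≤o M₁ M₂ m≥M) (ℕ.m⊔n≤o⇒n≤o M₁ M₂ n≥M))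
          (neary m n (ℕ.m⊔n≤o⇒n≤o N₁ N₂ m≥N) (ℕ.m⊔n≤o⇒n≤o N₁ N₂ n≥N)))

≤ℝ-refl : ∀ x → x ≤ℝ x
≤ℝ-refl x .eventually ε 0<ε = 0 , λ n _ → begin
  seq x n            ≡⟨ ℚ.+-identityʳ (seq x n) ⟨
  seq x n ℚ.+ 0ℚ     ≤⟨ ℚ.+-monoʳ-≤ (seq x n) (ℚ.<⇒≤ 0<ε) ⟩
  seq x n ℚ.+ ε      ∎
  where open ℚ.≤-Reasoning

infixl 6 _+ℝ_
infixl 7 _*ℝ_
infixr 8 _^ℝ_

_+ℝ_ : ℝ → ℝ → ℝ
(x +ℝ y) .seq n  = seq x n ℚ.+ seq y n
(x +ℝ y) .cauchy = sum-cauchy x y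

_*ℝ_ : ℝ → ℝ → ℝ
(x *ℝ y) .seq n  = seq x n ℚ.* seq y n
(x *ℝ y) .cauchy = product-cauchy x y

_^ℝ_ : ℝ → ℕ → ℝ
x ^ℝ zero  = 1ℝ
x ^ℝ suc k = x *ℝ x ^ℝ k

sumℝ productℝ : ∀ {n} → Vec ℝ n → ℝ
sumℝ     = Vec.foldr′ _+ℝ_ 0ℝ
productℝ = Vec.foldr′ _*ℝ_ 1ℝ

record ℝ⁺ : Set where
  constructor _,_
  field
    value  : ℝ
    nonneg : 0ℝ ≤ℝ value
open ℝ⁺ public

0⁺ : ℝ⁺
0⁺ = 0ℝ , ≤ℝ-refl 0ℝ

infix 4 _≥⁺_

_≥⁺_ : ℝ⁺ → ℝ⁺ → Set
x ≥⁺ y = value y ≤ℝ value x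

-- A polynomial in ℝ⁺[X₁,…,Xₙ] is a list of monomials a·X₁^k₁⋯Xₙ^kₙ, each given
-- by its coefficient a and its exponents k₁,…,kₙ.
Polynomial : ℕ → Set
Polynomial n = List (ℝ⁺ × Vec ℕ n)

evalPolynomial : ∀ {n} → Polynomial n → Vec ℝ⁺ n → ℝ
evalPolynomial p X = List.foldr _+ℝ_ 0ℝ (List.map monomial p)
  where
  monomial : ℝ⁺ × Vec ℕ _ → ℝ
  monomial (a , ks) = value a *ℝ productℝ (Vec.zipWith _^ℝ_ (Vec.map value X) ks)

-- Weak monotonicity makes a function respect _≈ℝ_; every assignment and weight
-- considered below is required to be weakly monotonic.
WeaklyMonotonic BoundedByPolynomial SubtermProperty :
  ∀ {n} → (Vec ℝ⁺ n → ℝ⁺) → Set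
WeaklyMonotonic F     = ∀ X Y → Pointwise _≥⁺_ X Y → F X ≥⁺ F Y
BoundedByPolynomial F = ∃[ p ] (∀ X → value (F X) ≤ℝ evalPolynomial p X)
SubtermProperty F     = ∀ X i → F X ≥⁺ lookup X i

------------------------------------------------------------------------
-- Syntax

-- A program defines each of its finitely many function symbols, so the function
-- symbols are taken to be Fin #Fct.
record Signature : Set₁ where
  field
    Cns Op : Set
    #Fct   : ℕ
    arityC : Cns → ℕ
    arityO : Op → ℕ
    arityF : Fin #Fct → ℕ
    TruthValue         : Cns → Set
    truthValue-nullary : ∀ c → TruthValue c → arityC c ≡ 0

  Fct : Set
  Fct = Fin #Fct

module Language (S : Signature) where
  open Signature S

  data Symbol : Set where
    cns : Cns → Symbol
    op  : Op  → Symbol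
    fct : Fct → Symbol

  arity : Symbol → ℕ
  arity (cns c) = arityC c
  arity (op o)  = arityO o
  arity (fct f) = arityF f

  -- Expressions and patterns are indexed by the set V of variables they may use;
  -- ground means V = ⊥.

  data Expr (V : Set) : Set where
    var : V → Expr V
    app : (b : Symbol) → Vec (Expr V) (arity b) → Expr V

  data Pattern (V : Set) : Set where
    var : V → Pattern V
    con : (c : Cns) → Vec (Pattern V) (arityC c) → Pattern V

  mutual
    ⌈_⌉ : ∀ {V} → Pattern V → Expr V
    ⌈ var x ⌉    = var x
    ⌈ con c ps ⌉ = app (cns c) ⌈ ps ⌉*

    ⌈_⌉* : ∀ {V n} → Vec (Pattern V) n → Vec (Expr V) n
    ⌈ [] ⌉*     = []
    ⌈ p ∷ ps ⌉* = ⌈ p ⌉ ∷ ⌈ ps ⌉*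

  mutual
    _[_] : ∀ {V W} → Expr V → (V → Expr W) → Expr W
    var x [ σ ]    = σ x
    app b es [ σ ] = app b (es [ σ ]*)

    _[_]* : ∀ {V W n} → Vec (Expr V) n → (V → Expr W) → Vec (Expr W) n
    [] [ σ ]*       = []
    (e ∷ es) [ σ ]* = e [ σ ] ∷ es [ σ ]*

  mutual
    _[_]ᵖ : ∀ {V W} → Pattern V → (V → Pattern W) → Pattern W
    var x [ σ ]ᵖ    = σ x
    con c ps [ σ ]ᵖ = con c (ps [ σ ]ᵖ*)

    _[_]ᵖ* : ∀ {V W n} → Vec (Pattern V) n → (V → Pattern W) → Vec (Pattern W) n
    [] [ σ ]ᵖ*       = []
    (p ∷ ps) [ σ ]ᵖ* = p [ σ ]ᵖ ∷ ps [ σ ]ᵖ*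

  data _∈ᵖ_ {V : Set} (x : V) : Pattern V → Set where
    here  : x ∈ᵖ var x
    there : ∀ {c ps} → Any (x ∈ᵖ_) ps → x ∈ᵖ con c ps

  data _occursIn_ {V : Set} (b : Symbol) : Expr V → Set where
    here  : ∀ {es} → b occursIn app b es
    there : ∀ {c es} → Any (b occursIn_) es → b occursIn app c es

  Value : Set
  Value = Pattern ⊥

  data Value* : Set where
    val : Value → Value*
    Err : Value*

  mutual
    ∣_∣ᵛ : Value → ℕ
    ∣ con c vs ∣ᵛ = sizeApp ∣ vs ∣ᵛ*

    ∣_∣ᵛ* : ∀ {n} → Vec Value n → Vec ℕ n
    ∣ [] ∣ᵛ*     = []
    ∣ v ∷ vs ∣ᵛ* = ∣ v ∣ᵛ ∷ ∣ vs ∣ᵛ*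

    sizeApp : ∀ {n} → Vec ℕ n → ℕ
    sizeApp []           = 0
    sizeApp ks@(_ ∷ _) = 1 ℕ.+ Vec.sum ks

  size : Value* → ℕ
  size (val v) = ∣ v ∣ᵛ
  size Err     = 0

  data _⊴_ (u : Value) : Value → Set where
    refl  : u ⊴ u
    there : ∀ {c vs} → Any (u ⊴_) vs → u ⊴ con c vs

  ----------------------------------------------------------------------
  -- Contexts with r holes: the fresh variables are the elements of Fin r

  mutual
    holeCount : ∀ {V r} → Fin r → Expr (V ⊎ Fin r) → ℕ
    holeCount i (var (inj₁ _)) = 0
    holeCount i (var (inj₂ j)) = if does (i ≟ j) then 1 else 0
    holeCount i (app b es)     = holeCount* i es

    holeCount* : ∀ {V r n} → Fin r → Vec (Expr (V ⊎ Fin r)) n → ℕ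
    holeCount* i []       = 0
    holeCount* i (e ∷ es) = holeCount i e ℕ.+ holeCount* i es

  record Context (V : Set) (r : ℕ) : Set where
    field
      expr   : Expr (V ⊎ Fin r)
      linear : ∀ i → holeCount i expr ≡ 1
  open Context public

  _⟪_⟫ : ∀ {V r} → Context V r → (Fin r → Expr V) → Expr V
  C ⟪ ds ⟫ = expr C [ [ var , ds ]′ ]

  Empty : ∀ {V} → Context V 1 → Set
  Empty C = expr C ≡ var (inj₂ zero)

  ----------------------------------------------------------------------
  -- Programs

  -- A branch p₁,…,pₙ → e of a definition of arity n. Pattern variables are bound
  -- by the branch, so they are named locally by Fin #vars; the right-hand side
  -- may use them (inj₂) and the parameters x₁,…,xₙ (inj₁).
  record Branch (n : ℕ) : Set where
    field
      #vars    : ℕ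
      patterns : Vec (Pattern (Fin #vars)) n
      occurs   : ∀ y → Any (y ∈ᵖ_) patterns
      rhs      : Expr (Fin n ⊎ Fin #vars)

  Match : ∀ {n} (B : Branch n) → Vec Value n → (Fin (Branch.#vars B) → Value) → Set
  Match B vs σ = Branch.patterns B [ σ ]ᵖ* ≡ vs

  NonOverlapping : ∀ {n ℓ} → Vec (Branch n) ℓ → Set
  NonOverlapping Bs = ∀ j k → j ≢ k → ∀ vs σ τ →
    ¬ (Match (lookup Bs j) vs σ × Match (lookup Bs k) vs τ)

  data Body (n : ℕ) : Set where
    compositional : Expr (Fin n) → Body n
    case          : ∀ {ℓ} (Bs : Vec (Branch n) ℓ) → NonOverlapping Bs → Body n

  -- A body is a set of clauses f(p₁,…,pₙ) → e: a compositional body has the single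
  -- clause f(x₁,…,xₙ) → e, a Case body has one clause for each branch.
  module _ {n : ℕ} where
    Clause : Body n → Set
    Clause (compositional _) = ⊤
    Clause (case {ℓ} _ _)    = Fin ℓ

    ClauseVar : (B : Body n) → Clause B → Set
    ClauseVar (compositional _) _ = Fin n
    ClauseVar (case Bs _)       j = Fin n ⊎ Fin (Branch.#vars (lookup Bs j))

    lhs : (B : Body n) (k : Clause B) → Vec (Pattern (ClauseVar B k)) n
    lhs (compositional _) _ = tabulate var
    lhs (case Bs _)       j = Branch.patterns (lookup Bs j) [ (λ y → var (inj₂ y)) ]ᵖ*

    rhs : (B : Body n) (k : Clause B) → Expr (ClauseVar B k)
    rhs (compositional e) _ = e
    rhs (case Bs _)       j = Branch.rhs (lookup Bs j)

    Fires : (B : Body n) (k : Clause B) → Vec Value n → (ClauseVar B k → Value) → Set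
    Fires (compositional _) _ vs σ = ∀ i → σ i ≡ lookup vs i
    Fires (case Bs _)       j vs σ =
      (∀ i → σ (inj₁ i) ≡ lookup vs i) × Match (lookup Bs j) vs (λ y → σ (inj₂ y))

  Destructor Predicate : ∀ {n} → (Vec Value n → Value*) → Set
  Destructor F = ∀ vs → F vs ≡ Err ⊎ ∃[ u ] (F vs ≡ val u × ∃[ i ] u ⊴ lookup vs i)
  Predicate  F = ∀ vs → F vs ≡ Err ⊎ ∃[ c ] ∃[ us ] (TruthValue c × F vs ≡ val (con c us))

  record Program : Set where
    field
      ⟦_⟧op    : (o : Op) → Vec Value (arityO o) → Value*
      op-basic : ∀ o → Destructor ⟦ o ⟧op ⊎ Predicate ⟦ o ⟧op
      body     : (f : Fct) → Body (arityF f)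

  module _ (P : Program) where
    open Program P

    --------------------------------------------------------------------
    -- Semantics: call-by-value evaluation of ground expressions

    infix 4 _⇓_

    data _⇓_ : Expr ⊥ → Value* → Set where
      ⇓cns  : ∀ {c es vs} → Pointwise (λ e v → e ⇓ val v) es vs →
              app (cns c) es ⇓ val (con c vs)
      ⇓op   : ∀ {o es vs} → Pointwise (λ e v → e ⇓ val v) es vs →
              app (op o) es ⇓ ⟦ o ⟧op vs
      ⇓fct  : ∀ {f es vs w} → Pointwise (λ e v → e ⇓ val v) es vs →
              (k : Clause (body f)) (σ : ClauseVar (body f) k → Value) →
              Fires (body f) k vs σ →
              rhs (body f) k [ (λ x → ⌈ σ x ⌉) ] ⇓ w →
              app (fct f) es ⇓ w
      ⇓fail : ∀ {f es vs} → Pointwise (λ e v → e ⇓ val v) es vs →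
              (∀ k σ → ¬ Fires (body f) k vs σ) →
              app (fct f) es ⇓ Err
      -- no other rule applies when some argument evaluates to Err
      ⇓err  : ∀ {b es} → Any (_⇓ Err) es → app b es ⇓ Err

    --------------------------------------------------------------------
    -- Activation, precedence and fraternities

    -- Activated f k d: d is activated by f(p₁,…,pₙ), where p₁,…,pₙ = lhs (body f) k.
    Activated : ∀ f (k : Clause (body f)) → Expr (ClauseVar (body f) k) → Set
    Activated f k d = ∃[ C ] rhs (body f) k ≡ C ⟪ (λ (_ : Fin 1) → d) ⟫

    Maximal : ∀ f (k : Clause (body f)) → Expr (ClauseVar (body f) k) → Set
    Maximal f k d = Activated f k d ×
      (∀ (C : Context _ 1) → Activated f k (C ⟪ (λ _ → d) ⟫) → Empty C)

    infix 4 _≥F_ _≈F_ _>F_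

    _≥F_ _≈F_ _>F_ : Fct → Fct → Set
    _≥F_ = Star (λ f g → ∃[ k ] ∃[ es ] Activated f k (app (fct g) es))
    f ≈F g = f ≥F g × g ≥F f
    f >F g = f ≥F g × ¬ (g ≥F f)

    record Fraternity (f : Fct) (k : Clause (body f)) : Set where
      field
        r       : ℕ
        r≥1     : 1 ℕ.≤ r
        context : Context (ClauseVar (body f) k) r
        callee  : Fin r → Fct
        args    : ∀ i → Vec (Expr (ClauseVar (body f) k)) (arityF (callee i))
        maximal : Maximal f k (context ⟪ (λ i → app (fct (callee i)) (args i)) ⟫)
        callee≈ : ∀ i → callee i ≈F f
        f>      : ∀ h → fct h occursIn expr context → f >F h

  ----------------------------------------------------------------------
  -- Assignments

  record Assignment : Set₁ where
    field
      dom     : Symbol → Set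
      ⟦_⟧     : (b : Symbol) → .(dom b) → Vec ℝ⁺ (arity b) → ℝ⁺
      cns∈dom : ∀ c → dom (cns c)
      op∈dom  : ∀ o → dom (op o)

  module _ (I : Assignment) where
    open Assignment I

    record Additive : Set where
      field
        bounded : ∀ b (d : dom b) → BoundedByPolynomial (⟦ b ⟧ d)
        cns>0   : ∀ c → 0 ℕ.< arityC c → ∃[ α ] (1ℝ ≤ℝ α ×
                  (∀ X → value (⟦ cns c ⟧ (cns∈dom c) X) ≈ℝ sumℝ (Vec.map value X) +ℝ α))
        cns≡0   : ∀ c → arityC c ≡ 0 → ∀ X → value (⟦ cns c ⟧ (cns∈dom c) X) ≈ℝ 0ℝ

    Total : Set
    Total = ∀ b → dom b

    mutual
      Defined : ∀ {V} → Expr V → Set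
      Defined (var x)    = ⊤
      Defined (app b es) = dom b × Defined* es

      Defined* : ∀ {V n} → Vec (Expr V) n → Set
      Defined* []       = ⊤
      Defined* (e ∷ es) = Defined e × Defined* es

    mutual
      extend : ∀ {V} (e : Expr V) → .(Defined e) → (V → ℝ⁺) → ℝ⁺
      extend (var x)    _ ρ = ρ x
      extend (app b es) d ρ = ⟦ b ⟧ (proj₁ d) (extend* es (proj₂ d) ρ)

      extend* : ∀ {V n} (es : Vec (Expr V) n) → .(Defined* es) → (V → ℝ⁺) → Vec ℝ⁺ n
      extend* []       _ ρ = []
      extend* (e ∷ es) d ρ = extend e (proj₁ d) ρ ∷ extend* es (proj₂ d) ρ

    mutual
      pattern-defined : ∀ {V} (p : Pattern V) → Defined ⌈ p ⌉
      pattern-defined (var x)    = _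
      pattern-defined (con c ps) = cns∈dom c , patterns-defined ps

      patterns-defined : ∀ {V n} (ps : Vec (Pattern V) n) → Defined* ⌈ ps ⌉*
      patterns-defined []       = _
      patterns-defined (p ∷ ps) = pattern-defined p , patterns-defined ps

    mutual
      total⇒defined : Total → ∀ {V} (e : Expr V) → Defined e
      total⇒defined t (var x)    = _
      total⇒defined t (app b es) = t b , total⇒defined* t es

      total⇒defined* : Total → ∀ {V n} (es : Vec (Expr V) n) → Defined* es
      total⇒defined* t []       = _
      total⇒defined* t (e ∷ es) = total⇒defined t e , total⇒defined* t es

    extendValue* : Value* → ℝ⁺
    extendValue* (val v) = extend ⌈ v ⌉ (pattern-defined v) ⊥-elim
    extendValue* Err     = 0⁺

  record Weight : Set where
    field
      ω         : (f : Fct) → Vec ℝ⁺ (arityF f) → ℝ⁺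
      bounded   : ∀ f → BoundedByPolynomial (ω f)
      monotonic : ∀ f → WeaklyMonotonic (ω f)
      subterm   : ∀ f → SubtermProperty (ω f)

  module _ (P : Program) where
    open Program P

    record IsSupInterpretation (θ : Assignment) : Set where
      open Assignment θ
      field
        additive  : Additive θ
        monotonic : ∀ b (d : dom b) → WeaklyMonotonic (⟦ b ⟧ d)
        size-≤    : ∀ w → fromℕ (size w) ≤ℝ value (extendValue* θ w)
        sup       : ∀ b (d : dom b) (vs : Vec Value (arity b)) w →
                    _⇓_ P (app b ⌈ vs ⌉*) w →
                    extend θ (app b ⌈ vs ⌉*) (d , patterns-defined θ vs) ⊥-elim
                      ≥⁺ extendValue* θ w

    record Friendly (θ : Assignment) (W : Weight)
                    {f : Fct} {k : Clause (body f)} (F : Fraternity P f k) : Set where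
      open Fraternity F
      open Weight W
      field
        context-defined : Defined θ (expr context)
        args-defined    : ∀ i → Defined* θ (args i)

      ωf : (ClauseVar (body f) k → ℝ⁺) → ℝ⁺
      ωf ρ = ω f (extend* θ ⌈ lhs (body f) k ⌉* (patterns-defined θ (lhs (body f) k)) ρ)

      ωg : (ClauseVar (body f) k → ℝ⁺) → Fin r → ℝ⁺
      ωg ρ i = ω (callee i) (extend* θ (args i) (args-defined i) ρ)

      field
        -- ωf ρ ≥ max (ωg ρ i) over i, spelled out for each i
        ≥max     : ∀ ρ i → ωf ρ ≥⁺ ωg ρ i
        ≥context : ∀ ρ → ωf ρ ≥⁺ extend θ (expr context) context-defined [ ρ , ωg ρ ]′

    QuasiFriendly : Set₁
    QuasiFriendly = Σ Assignment λ θ → IsSupInterpretation θ × Σ Weight λ W →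
      ∀ f k (F : Fraternity P f k) → Friendly θ W F

    record IsQuasiInterpretation (I : Assignment) : Set where
      open Assignment I
      field
        total     : Total I
        additive  : Additive I
        monotonic : ∀ b → WeaklyMonotonic (⟦ b ⟧ (total b))
        subterm   : ∀ b → SubtermProperty (⟦ b ⟧ (total b))
        decreasing : ∀ f k e → Maximal P f k e → ∀ ρ →
          extend I (app (fct f) ⌈ lhs (body f) k ⌉*)
                   (total⇒defined I total (app (fct f) ⌈ lhs (body f) k ⌉*)) ρ
            ≥⁺ extend I e (total⇒defined I total e) ρ

    AdmitsQuasiInterpretation : Set₁
    AdmitsQuasiInterpretation = Σ Assignment IsQuasiInterpretation

{-# OPTIONS --safe #-}
module Submission where

-- A quasi-interpretation serves as its own sup-interpretation, and its restriction
-- to function symbols as the weight. Soundness with respect to evaluation is an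
-- induction on derivations: the body of a clause is itself a maximal activated
-- expression, so a call dominates the body it unfolds to. A fraternity is maximal
-- too, which is the second friendliness condition; the first follows from it because
-- the holes of the context are subterms.

open import Defs
open import Data.Empty using (⊥; ⊥-elim)
open import Data.Fin using (Fin; zero; suc)
open import Data.Fin.Properties using (_≟_)
open import Data.Integer as ℤ using (+_)
import Data.Integer.Properties as ℤ
open import Data.Nat as ℕ using (ℕ; zero; suc)
import Data.Nat.Properties as ℕ
open import Data.Product using (∃-syntax; _,_; proj₁; proj₂)
open import Data.Rational as ℚ using (½)
import Data.Rational.Properties as ℚ
open import Data.Rational.Solver using (module +-*-Solver)
import Data.Rational.Unnormalised as ℚᵘ
import Data.Rational.Unnormalised.Properties as ℚᵘ
open import Data.Sum using (_⊎_; inj₁; inj₂; [_,_]′)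
open import Data.Vec as Vec using (Vec; []; _∷_; lookup; tabulate)
open import Data.Vec.Properties using (tabulate∘lookup; tabulate-cong)
open import Data.Vec.Relation.Binary.Pointwise.Inductive using (Pointwise; []; _∷_)
open import Data.Vec.Relation.Unary.Any using (Any; here; there)
open import Function using (_∘_)
open import Relation.Binary.PropositionalEquality
  using (_≡_; refl; sym; trans; cong; cong₂; subst)
open import Relation.Nullary using (yes; no)

-- Order on the reals

≤ℝ-trans : ∀ {x y z} → x ≤ℝ y → y ≤ℝ z → x ≤ℝ z
≤ℝ-trans {x} {y} {z} x≤y y≤z .eventually ε 0<ε =
  let M , x≤y+δ = eventually x≤y δ 0<δ
      N , y≤z+δ = eventually y≤z δ 0<δ
  in M ℕ.⊔ N , λ n n≥ → begin
    seq x n               ≤⟨ x≤y+δ n (ℕ.m⊔n≤o⇒m≤o M N n≥) ⟩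
    seq y n ℚ.+ δ         ≤⟨ ℚ.+-monoˡ-≤ δ (y≤z+δ n (ℕ.m⊔n≤o⇒n≤o M N n≥)) ⟩
    seq z n ℚ.+ δ ℚ.+ δ   ≡⟨ regroup (seq z n) ε ⟩
    seq z n ℚ.+ ε         ∎
  where
  open ℚ.≤-Reasoning
  open +-*-Solver using (solve; _:=_; _:+_; _:*_; con)
  δ = ½ ℚ.* ε
  0<δ = ℚ.positive⁻¹ δ {{ℚ.pos*pos⇒pos ½ ε {{ℚ.positive 0<ε}}}}
  regroup : ∀ a e → a ℚ.+ ½ ℚ.* e ℚ.+ ½ ℚ.* e ≡ a ℚ.+ e
  regroup = solve 2 (λ a e → a :+ con ½ :* e :+ con ½ :* e := a :+ e) refl

+ℝ-mono : ∀ {x y u v} → x ≤ℝ y → u ≤ℝ v → x +ℝ u ≤ℝ y +ℝ v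
+ℝ-mono {x} {y} {u} {v} x≤y u≤v .eventually ε 0<ε =
  let M , x≤y+δ = eventually x≤y δ 0<δ
      N , u≤v+δ = eventually u≤v δ 0<δ
  in M ℕ.⊔ N , λ n n≥ → begin
    seq x n ℚ.+ seq u n
      ≤⟨ ℚ.+-mono-≤ (x≤y+δ n (ℕ.m⊔n≤o⇒m≤o M N n≥)) (u≤v+δ n (ℕ.m⊔n≤o⇒n≤o M N n≥)) ⟩
    (seq y n ℚ.+ δ) ℚ.+ (seq v n ℚ.+ δ)
      ≡⟨ regroup (seq y n) (seq v n) ε ⟩
    (seq y n ℚ.+ seq v n) ℚ.+ ε ∎
  where
  open ℚ.≤-Reasoning
  open +-*-Solver using (solve; _:=_; _:+_; _:*_; con)
  δ = ½ ℚ.* ε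
  0<δ = ℚ.positive⁻¹ δ {{ℚ.pos*pos⇒pos ½ ε {{ℚ.positive 0<ε}}}}
  regroup : ∀ a b e → (a ℚ.+ ½ ℚ.* e) ℚ.+ (b ℚ.+ ½ ℚ.* e) ≡ (a ℚ.+ b) ℚ.+ e
  regroup = solve 3 (λ a b e →
    (a :+ con ½ :* e) :+ (b :+ con ½ :* e) := (a :+ b) :+ e) refl

seq-≤⇒≤ℝ : ∀ {x y} → (∀ n → seq x n ℚ.≤ seq y n) → x ≤ℝ y
seq-≤⇒≤ℝ {x} {y} x≤y .eventually ε 0<ε = 0 , λ n _ →
  ℚ.≤-trans (x≤y n) (ℚ.≤-trans (ℚ.≤-reflexive (sym (ℚ.+-identityʳ (seq y n))))
    (ℚ.+-monoʳ-≤ (seq y n) (ℚ.<⇒≤ 0<ε)))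

-- `_/_` normalises by a gcd, so neither side computes for variable `m` and `n`. In unnormalised
-- rationals equality is cross-multiplication, which here comes down to multiplying by 1.
/1-homo-+ : ∀ m n → + (m ℕ.+ n) ℚ./ 1 ≡ + m ℚ./ 1 ℚ.+ + n ℚ./ 1
/1-homo-+ m n = ℚ.toℚᵘ-injective (begin
  ℚ.toℚᵘ (+ (m ℕ.+ n) ℚ./ 1)
    ≈⟨ ℚ.toℚᵘ-fromℚᵘ (ℚᵘ.mkℚᵘ (+ (m ℕ.+ n)) 0) ⟩
  ℚᵘ.mkℚᵘ (+ (m ℕ.+ n)) 0
    ≈⟨ ℚᵘ.*≡* (cong (ℤ._* + 1)
         (sym (cong₂ ℤ._+_ (ℤ.*-identityʳ (+ m)) (ℤ.*-identityʳ (+ n))))) ⟩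
  ℚᵘ.mkℚᵘ (+ m) 0 ℚᵘ.+ ℚᵘ.mkℚᵘ (+ n) 0
    ≈⟨ ℚᵘ.+-cong (ℚ.toℚᵘ-fromℚᵘ (ℚᵘ.mkℚᵘ (+ m) 0)) (ℚ.toℚᵘ-fromℚᵘ (ℚᵘ.mkℚᵘ (+ n) 0)) ⟨
  ℚ.toℚᵘ (+ m ℚ./ 1) ℚᵘ.+ ℚ.toℚᵘ (+ n ℚ./ 1)
    ≈⟨ ℚ.toℚᵘ-homo-+ (+ m ℚ./ 1) (+ n ℚ./ 1) ⟨
  ℚ.toℚᵘ (+ m ℚ./ 1 ℚ.+ + n ℚ./ 1) ∎)
  where open ℚᵘ.≃-Reasoning

fromℕ-subadditive : ∀ m n → fromℕ (m ℕ.+ n) ≤ℝ fromℕ m +ℝ fromℕ n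
fromℕ-subadditive m n = seq-≤⇒≤ℝ λ _ → ℚ.≤-reflexive (/1-homo-+ m n)

+ℝ-comm-≤ : ∀ x y → x +ℝ y ≤ℝ y +ℝ x
+ℝ-comm-≤ x y = seq-≤⇒≤ℝ λ n → ℚ.≤-reflexive (ℚ.+-comm (seq x n) (seq y n))

-- Flipped so that chains of `_≥⁺_`, which unfolds to `_≤ℝ_` between values, read from the larger
-- side down.
≥ℝ-trans : ∀ {x y z} → y ≤ℝ x → z ≤ℝ y → z ≤ℝ x
≥ℝ-trans x≥y y≥z = ≤ℝ-trans y≥z x≥y

≥⁺-reflexive : ∀ {x y} → x ≡ y → x ≥⁺ y
≥⁺-reflexive {x} refl = ≤ℝ-refl (value x)

module _ {S : Signature} where
  open Signature S
  open Language S

  -- Substitution and contexts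

  mutual
    ᵖ-∘ : ∀ {U V W} (p : Pattern U) {σ : U → Pattern V} {τ : V → Pattern W} →
          p [ σ ]ᵖ [ τ ]ᵖ ≡ p [ (λ x → σ x [ τ ]ᵖ) ]ᵖ
    ᵖ-∘ (var x)    = refl
    ᵖ-∘ (con c ps) = cong (con c) (ᵖ*-∘ ps)

    ᵖ*-∘ : ∀ {U V W n} (ps : Vec (Pattern U) n) {σ : U → Pattern V} {τ : V → Pattern W} →
           ps [ σ ]ᵖ* [ τ ]ᵖ* ≡ ps [ (λ x → σ x [ τ ]ᵖ) ]ᵖ*
    ᵖ*-∘ []       = refl
    ᵖ*-∘ (p ∷ ps) = cong₂ _∷_ (ᵖ-∘ p) (ᵖ*-∘ ps)

  tabulate-ᵖ* : ∀ {V W n} (f : Fin n → Pattern V) {σ : V → Pattern W} →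
                tabulate f [ σ ]ᵖ* ≡ tabulate (λ i → f i [ σ ]ᵖ)
  tabulate-ᵖ* {n = zero}  f = refl
  tabulate-ᵖ* {n = suc n} f = cong (f zero [ _ ]ᵖ ∷_) (tabulate-ᵖ* (f ∘ suc))

  -- A compositional body has the parameters as patterns, and `σ` sends them to the arguments. In a
  -- Case clause the renaming by `inj₂` fuses with `σ`, which leaves the match of the branch.
  lhs-matches : ∀ {n} (B : Body n) (k : Clause B) {vs} {σ : ClauseVar B k → Value} →
                Fires B k vs σ → lhs B k [ σ ]ᵖ* ≡ vs
  lhs-matches (compositional _) _ {vs} σ≡vs =
    trans (tabulate-ᵖ* var) (trans (tabulate-cong σ≡vs) (tabulate∘lookup vs))
  lhs-matches (case Bs _) j (_ , matches) =
    trans (ᵖ*-∘ (Branch.patterns (lookup Bs j))) matches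

  -- The linearity of a context is only a count. This gives the path from the root to a hole, along
  -- which inductions can run.
  data _∈ᵉ_ {V : Set} (x : V) : Expr V → Set where
    here  : x ∈ᵉ var x
    there : ∀ {b es} → Any (x ∈ᵉ_) es → x ∈ᵉ app b es

  mutual
    hole⇒∈ᵉ : ∀ {V r} {i : Fin r} (e : Expr (V ⊎ Fin r)) → 0 ℕ.< holeCount i e → inj₂ i ∈ᵉ e
    hole⇒∈ᵉ {i = i} (var (inj₂ j)) 0< with i ≟ j
    ... | yes refl = here
    hole⇒∈ᵉ (app b es) 0< = there (hole⇒∈ᵉ* es 0<)

    hole⇒∈ᵉ* : ∀ {V r n} {i : Fin r} (es : Vec (Expr (V ⊎ Fin r)) n) →
               0 ℕ.< holeCount* i es → Any (inj₂ i ∈ᵉ_) es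
    hole⇒∈ᵉ* {i = i} (e ∷ es) 0< with holeCount i e in eq
    ... | zero  = there (hole⇒∈ᵉ* es 0<)
    ... | suc _ = here (hole⇒∈ᵉ e (subst (0 ℕ.<_) (sym eq) ℕ.z<s))

  hole∈context : ∀ {V r} (C : Context V r) i → inj₂ i ∈ᵉ expr C
  hole∈context C i = hole⇒∈ᵉ (expr C) (subst (0 ℕ.<_) (sym (linear C i)) ℕ.z<s)

  mutual
    -- Counts symbol occurrences, as a measure that every nonempty one-hole context strictly
    -- increases.
    nodes : ∀ {V} → Expr V → ℕ
    nodes (var _)    = 0
    nodes (app _ es) = suc (nodes* es)

    nodes* : ∀ {V n} → Vec (Expr V) n → ℕ
    nodes* []       = 0
    nodes* (e ∷ es) = nodes e ℕ.+ nodes* es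

  mutual
    nodes-[] : ∀ {V W} {x : V} {e : Expr V} (σ : V → Expr W) →
               x ∈ᵉ e → nodes (σ x) ℕ.≤ nodes (e [ σ ])
    nodes-[] σ here       = ℕ.≤-refl
    nodes-[] σ (there x∈) = ℕ.m≤n⇒m≤1+n (nodes-[]* σ x∈)

    nodes-[]* : ∀ {V W n} {x : V} {es : Vec (Expr V) n} (σ : V → Expr W) →
                Any (x ∈ᵉ_) es → nodes (σ x) ℕ.≤ nodes* (es [ σ ]*)
    nodes-[]* σ (here x∈) =
      ℕ.≤-trans (nodes-[] σ x∈) (ℕ.m≤m+n _ _)
    nodes-[]* {es = e ∷ _} σ (there x∈) =
      ℕ.≤-trans (nodes-[]* σ x∈) (ℕ.m≤n+m _ (nodes (e [ σ ])))

  nodes-⟪⟫ : ∀ {V} (C : Context V 1) d → nodes d ℕ.≤ nodes (C ⟪ (λ _ → d) ⟫)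
  nodes-⟪⟫ C d = nodes-[] [ var , (λ _ → d) ]′ (hole∈context C zero)

  -- If the hole is not at the root, a symbol of `C` lies above the copy of `d` and makes the filled
  -- context strictly larger than `d`.
  nodes-⟪⟫⇒Empty : ∀ {V} (C : Context V 1) d →
                   nodes (C ⟪ (λ _ → d) ⟫) ℕ.≤ nodes d → Empty C
  -- Abstracting `expr C` together with the path lets `here` identify it with the bare hole.
  nodes-⟪⟫⇒Empty C d ≤d with expr C | hole∈context C zero
  ... | _ | here     = refl
  ... | _ | there x∈ = ⊥-elim (ℕ.<⇒≱ (ℕ.s≤s (nodes-[]* [ var , (λ _ → d) ]′ x∈)) ≤d)

  ◇ : ∀ {V} → Context V 1
  ◇ .expr        = var (inj₂ zero)
  ◇ .linear zero = refl

  -- If the body were `D ⟪ C ⟪ rhs ⟫ ⟫`, then `C ⟪ rhs ⟫` would have at most as many nodes as `rhs`,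
  -- which forces `C` to be empty. Thus `decreasing` applies to whole bodies.
  rhs-maximal : ∀ P f k → Maximal P f k (rhs (Program.body P f) k)
  rhs-maximal P f k = (◇ , refl) , λ C (D , rhs≡D⟪C⟪rhs⟫⟫) →
    nodes-⟪⟫⇒Empty C _
      (subst (λ e → nodes (C ⟪ (λ _ → _) ⟫) ℕ.≤ nodes e) (sym rhs≡D⟪C⟪rhs⟫⟫)
        (nodes-⟪⟫ D _))

  -- Total assignments

  sizeApp-nullary : ∀ {n} (ks : Vec ℕ n) → n ≡ 0 → sizeApp ks ≡ 0
  sizeApp-nullary [] _ = refl

  sizeApp-nonnullary : ∀ {n} (ks : Vec ℕ n) → 0 ℕ.< n → sizeApp ks ≡ suc (Vec.sum ks)
  sizeApp-nonnullary (_ ∷ _) _ = refl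

  module TotalAssignment (I : Assignment) (total : Total I) where
    open Assignment I

    -- Definedness proofs are irrelevant arguments of `extend`, so `eval` agrees definitionally with
    -- `extend` at any other proof, in particular with `extendValue*` on values.
    eval : ∀ {V} → Expr V → (V → ℝ⁺) → ℝ⁺
    eval e = extend I e (total⇒defined I total e)

    eval* : ∀ {V n} → Vec (Expr V) n → (V → ℝ⁺) → Vec ℝ⁺ n
    eval* es = extend* I es (total⇒defined* I total es)

    mutual
      eval-[] : ∀ {V W} (e : Expr V) {σ : V → Expr W} {ρ} →
                eval (e [ σ ]) ρ ≡ eval e (λ x → eval (σ x) ρ)
      eval-[] (var x)    = refl
      eval-[] (app b es) = cong (⟦ b ⟧ (total b)) (eval*-[] es)

      eval*-[] : ∀ {V W n} (es : Vec (Expr V) n) {σ : V → Expr W} {ρ} →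
                 eval* (es [ σ ]*) ρ ≡ eval* es (λ x → eval (σ x) ρ)
      eval*-[] []       = refl
      eval*-[] (e ∷ es) = cong₂ _∷_ (eval-[] e) (eval*-[] es)

    mutual
      eval-[]ᵖ : ∀ {V W} (p : Pattern V) {σ : V → Pattern W} {ρ} →
                 eval ⌈ p [ σ ]ᵖ ⌉ ρ ≡ eval ⌈ p ⌉ (λ x → eval ⌈ σ x ⌉ ρ)
      eval-[]ᵖ (var x)    = refl
      eval-[]ᵖ (con c ps) = cong (⟦ cns c ⟧ (total (cns c))) (eval*-[]ᵖ ps)

      eval*-[]ᵖ : ∀ {V W n} (ps : Vec (Pattern V) n) {σ : V → Pattern W} {ρ} →
                  eval* ⌈ ps [ σ ]ᵖ* ⌉* ρ ≡ eval* ⌈ ps ⌉* (λ x → eval ⌈ σ x ⌉ ρ)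
      eval*-[]ᵖ []       = refl
      eval*-[]ᵖ (p ∷ ps) = cong₂ _∷_ (eval-[]ᵖ p) (eval*-[]ᵖ ps)

    mutual
      eval-cong : ∀ {V} (e : Expr V) {ρ ρ′} → (∀ x → ρ x ≡ ρ′ x) → eval e ρ ≡ eval e ρ′
      eval-cong (var x)    ρ≡ρ′ = ρ≡ρ′ x
      eval-cong (app b es) ρ≡ρ′ = cong (⟦ b ⟧ (total b)) (eval*-cong es ρ≡ρ′)

      eval*-cong : ∀ {V n} (es : Vec (Expr V) n) {ρ ρ′} → (∀ x → ρ x ≡ ρ′ x) →
                   eval* es ρ ≡ eval* es ρ′
      eval*-cong []       ρ≡ρ′ = refl
      eval*-cong (e ∷ es) ρ≡ρ′ = cong₂ _∷_ (eval-cong e ρ≡ρ′) (eval*-cong es ρ≡ρ′)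

    eval-⟪⟫ : ∀ {V r} (C : Context V r) {ds ρ} →
              eval (C ⟪ ds ⟫) ρ ≡ eval (expr C) [ ρ , (λ i → eval (ds i) ρ) ]′
    eval-⟪⟫ C = trans (eval-[] (expr C))
      (eval-cong (expr C) λ { (inj₁ _) → refl ; (inj₂ _) → refl })

    lookup-eval* : ∀ {V n} (vs : Vec (Pattern V) n) {ρ} i →
                   lookup (eval* ⌈ vs ⌉* ρ) i ≡ eval ⌈ lookup vs i ⌉ ρ
    lookup-eval* (v ∷ vs) zero    = refl
    lookup-eval* (v ∷ vs) (suc i) = lookup-eval* vs i

    module _ (subterm : ∀ b → SubtermProperty (⟦ b ⟧ (total b))) where

      mutual
        -- The subterm property is applied once at each symbol on the path to `x`.
        eval-∈ᵉ : ∀ {V} {x : V} {e ρ} → x ∈ᵉ e → eval e ρ ≥⁺ ρ x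
        eval-∈ᵉ here       = ≤ℝ-refl _
        eval-∈ᵉ (there x∈) = let i , ≥x = eval*-∈ᵉ x∈ in ≥ℝ-trans (subterm _ _ i) ≥x

        eval*-∈ᵉ : ∀ {V n} {x : V} {es : Vec (Expr V) n} {ρ} → Any (x ∈ᵉ_) es →
                   ∃[ i ] lookup (eval* es ρ) i ≥⁺ ρ x
        eval*-∈ᵉ (here x∈)  = zero , eval-∈ᵉ x∈
        eval*-∈ᵉ (there x∈) = let i , ≥x = eval*-∈ᵉ x∈ in suc i , ≥x

      mutual
        -- The same descent along a subterm path; it bounds the results of destructors.
        eval-⊴ : ∀ {u v} → u ⊴ v → eval ⌈ v ⌉ ⊥-elim ≥⁺ eval ⌈ u ⌉ ⊥-elim
        eval-⊴ refl       = ≤ℝ-refl _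
        eval-⊴ (there u⊴) = let i , ≥u = eval*-⊴ u⊴ in ≥ℝ-trans (subterm _ _ i) ≥u

        eval*-⊴ : ∀ {u n} {vs : Vec Value n} → Any (u ⊴_) vs →
                  ∃[ i ] lookup (eval* ⌈ vs ⌉* ⊥-elim) i ≥⁺ eval ⌈ u ⌉ ⊥-elim
        eval*-⊴ (here u⊴)  = zero , eval-⊴ u⊴
        eval*-⊴ (there u⊴) = let i , ≥u = eval*-⊴ u⊴ in suc i , ≥u

    module _ (additive : Additive I) where
      open Additive additive

      mutual
        -- The additive constant, at least 1, pays for the root symbol, and the sum pays for the
        -- arguments.
        ∣v∣≤eval : ∀ v → fromℕ ∣ v ∣ᵛ ≤ℝ value (eval ⌈ v ⌉ ⊥-elim)
        -- The arity is a neutral term, so `sizeApp` reduces only after it is known to be zero or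
        -- positive.
        ∣v∣≤eval (con c vs) with ℕ.m≤n⇒m<n∨m≡n {n = arityC c} ℕ.z≤n
        ... | inj₂ 0≡n = subst (λ m → fromℕ m ≤ℝ value (eval ⌈ con c vs ⌉ ⊥-elim))
          (sym (sizeApp-nullary ∣ vs ∣ᵛ* (sym 0≡n))) (nonneg (eval ⌈ con c vs ⌉ ⊥-elim))
        ... | inj₁ 0<n = let α , 1≤α , ≈sum+α = cns>0 c 0<n in
          subst (λ m → fromℕ m ≤ℝ value (eval ⌈ con c vs ⌉ ⊥-elim))
            (sym (sizeApp-nonnullary ∣ vs ∣ᵛ* 0<n))
          (≤ℝ-trans (fromℕ-subadditive 1 (Vec.sum ∣ vs ∣ᵛ*))
          (≤ℝ-trans (+ℝ-mono 1≤α (∣vs∣≤eval* vs))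
          (≤ℝ-trans (+ℝ-comm-≤ α _)
                    (proj₂ (≈sum+α (eval* ⌈ vs ⌉* ⊥-elim))))))

        ∣vs∣≤eval* : ∀ {n} (vs : Vec Value n) →
                     fromℕ (Vec.sum ∣ vs ∣ᵛ*) ≤ℝ sumℝ (Vec.map value (eval* ⌈ vs ⌉* ⊥-elim))
        ∣vs∣≤eval* []       = ≤ℝ-refl 0ℝ
        ∣vs∣≤eval* (v ∷ vs) = ≤ℝ-trans (fromℕ-subadditive ∣ v ∣ᵛ _)
          (+ℝ-mono (∣v∣≤eval v) (∣vs∣≤eval* vs))

  -- Quasi-interpretations

  module _ {P : Program} {I : Assignment} (Q : IsQuasiInterpretation P I) where
    open Assignment I
    open Program P
    open IsQuasiInterpretation Q
    open TotalAssignment I total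

    -- `decreasing` speaks of function symbols only, so the bound for operators comes from
    -- `op-basic`: a result is a subterm of an argument, a truth value assigned 0, or `Err`, also
    -- assigned 0.
    ⟦op⟧-≤ : ∀ o vs →
             ⟦ op o ⟧ (total (op o)) (eval* ⌈ vs ⌉* ⊥-elim) ≥⁺ extendValue* I (⟦ o ⟧op vs)
    -- The specification is instantiated at `vs` so that abstracting the result also rewrites its
    -- equations, which `refl` then solves.
    ⟦op⟧-≤ o vs with ⟦ o ⟧op vs | [ (λ d → inj₁ (d vs)) , (λ p → inj₂ (p vs)) ]′ (op-basic o)
    ... | _ | inj₁ (inj₁ refl) = nonneg (⟦ op o ⟧ (total (op o)) _)
    ... | _ | inj₁ (inj₂ (u , refl , i , u⊴)) = ≥ℝ-trans (subterm (op o) _ i)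
      (≥ℝ-trans (≥⁺-reflexive (lookup-eval* vs i)) (eval-⊴ subterm u⊴))
    ... | _ | inj₂ (inj₁ refl) = nonneg (⟦ op o ⟧ (total (op o)) _)
    ... | _ | inj₂ (inj₂ (c , us , true , refl)) =
      ≤ℝ-trans (proj₁ (Additive.cns≡0 additive c (truthValue-nullary c true) _))
        (nonneg (⟦ op o ⟧ (total (op o)) _))

    mutual
      -- Stated for all ground expressions, not just symbols applied to values, since the induction
      -- passes through instantiated bodies.
      eval-⇓ : ∀ {e w} → _⇓_ P e w → eval e ⊥-elim ≥⁺ extendValue* I w
      eval-⇓ (⇓cns es⇓) = monotonic _ _ _ (eval*-⇓ es⇓)
      eval-⇓ (⇓op {vs = vs} es⇓) = ≥ℝ-trans (monotonic _ _ _ (eval*-⇓ es⇓)) (⟦op⟧-≤ _ vs)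
      eval-⇓ (⇓fct {f} {vs = vs} es⇓ k σ fires rhs⇓) =
        -- Evaluate the arguments, read them as the instance of the patterns under `ρ`, decrease to
        -- the body under `ρ`, turn `ρ` back into the substitution `σ`, and use induction.
        ≥ℝ-trans (monotonic (fct f) _ _ (eval*-⇓ es⇓))
        (≥ℝ-trans (≥⁺-reflexive (cong (⟦ fct f ⟧ (total (fct f))) vs≡lhs))
        (≥ℝ-trans (decreasing f k _ (rhs-maximal P f k) ρ)
        (≥ℝ-trans (≥⁺-reflexive (sym (eval-[] (rhs (body f) k))))
                  (eval-⇓ rhs⇓))))
        where
        ρ : ClauseVar (body f) k → ℝ⁺
        ρ x = eval ⌈ σ x ⌉ ⊥-elim
        vs≡lhs : eval* ⌈ vs ⌉* ⊥-elim ≡ eval* ⌈ lhs (body f) k ⌉* ρ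
        vs≡lhs = trans
          (cong (λ us → eval* ⌈ us ⌉* ⊥-elim) (sym (lhs-matches (body f) k fires)))
          (eval*-[]ᵖ (lhs (body f) k))
      -- `Err` is assigned 0, so nonnegativity suffices.
      eval-⇓ {e} (⇓fail _ _) = nonneg (eval e ⊥-elim)
      eval-⇓ {e} (⇓err _)    = nonneg (eval e ⊥-elim)

      eval*-⇓ : ∀ {n} {es : Vec (Expr ⊥) n} {vs : Vec Value n} →
                Pointwise (λ e v → _⇓_ P e (val v)) es vs →
                Pointwise _≥⁺_ (eval* es ⊥-elim) (eval* ⌈ vs ⌉* ⊥-elim)
      eval*-⇓ []         = []
      eval*-⇓ (e⇓ ∷ es⇓) = eval-⇓ e⇓ ∷ eval*-⇓ es⇓

    isSupInterpretation : IsSupInterpretation P I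
    isSupInterpretation = record
      { additive  = additive
      ; monotonic = λ b _ → monotonic b
      ; size-≤    = λ { (val v) → ∣v∣≤eval additive v ; Err → ≤ℝ-refl 0ℝ }
      ; sup       = λ _ _ _ _ → eval-⇓
      }

    weight : Weight
    weight = record
      { ω         = λ f → ⟦ fct f ⟧ (total (fct f))
      ; bounded   = λ f → Additive.bounded additive (fct f) (total (fct f))
      ; monotonic = λ f → monotonic (fct f)
      ; subterm   = λ f → subterm (fct f)
      }

    friendly : ∀ {f k} (F : Fraternity P f k) → Friendly P I weight F
    friendly {f} {k} F = record
      { context-defined = total⇒defined I total (expr context)
      ; args-defined    = λ i → total⇒defined* I total (args i)
      -- The valuation of hole `i` is the weight of the `i`-th call, and the hole occurs in the
      -- context.
      ; ≥max            = λ ρ i → ≥ℝ-trans (lhs≥context ρ)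
          (eval-∈ᵉ subterm (hole∈context context i))
      ; ≥context        = lhs≥context
      }
      where
      open Fraternity F
      call : ∀ i → Expr (ClauseVar (body f) k)
      call i = app (fct (callee i)) (args i)
      -- As the weight is `I` itself, `eval (call i) ρ` is by definition the weight of the `i`-th
      -- call.
      lhs≥context : ∀ ρ → eval (app (fct f) ⌈ lhs (body f) k ⌉*) ρ ≥⁺
                    eval (expr context) [ ρ , (λ i → eval (call i) ρ) ]′
      lhs≥context ρ = ≥ℝ-trans (decreasing f k _ maximal ρ)
        (≥⁺-reflexive (eval-⟪⟫ context))

theorem4 : (S : Signature) (P : Language.Program S) →
    Language.AdmitsQuasiInterpretation S P → Language.QuasiFriendly S P
theorem4 S P (I , Q) = I , isSupInterpretation Q , weight Q , λ _ _ → friendly Q
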